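{- Let $q$ be a prime power with $q\equiv 1\pmod 3$. Let $\Pi\simeq\mathrm{PG}(7,q)$ be the trace-zero hyperplane of $\mathrm{PG}(8,q)$, let $\Gamma$ be the thin hexagon in $\Pi$, and let $\mathcal{O}=\bigcup_{x\in\Gamma}\pi_x$, where $x$ ranges over all points of $\Gamma$ and $\pi_x$ is the plane spanned by the two lines of $\Gamma$ through $x$ (all as defined in the context). Then $\mathcal{O}$ is not contained in a hyperplane of $\Pi$.
   Context: Let $q\equiv 1\pmod 3$ be a prime power and let $\mathrm{PG}(8,q)$ have homogeneous coordinates $X_1,\dots,X_9$ over the finite field $\mathbb{F}_q$. Identify a $3\times 3$ matrix $M=(m_{ij})$ over $\mathbb{F}_q$ with the vector $(m_{11},m_{12},m_{13},m_{21},m_{22},m_{23},m_{31},m_{32},m_{33})\in\mathbb{F}_q^9$. $\mathcal{S}_{2,2}$ is the Segre variety, the set of $(q^2+q+1)^2$ points of $\mathrm{PG}(8,q)$ represented by $(a_1b_1,a_1b_2,a_1b_3,a_2b_1,a_2b_2,a_2b_3,a_3b_1,a_3b_2,a_3b_3)$ with $a_i,b_i\in\mathbb{F}_q$, $(a_1,a_2,a_3)\neq(0,0,0)$ and $(b_1,b_2,b_3)\ne(0,0,0)$, i.e. the points corresponding to rank-one matrices. $\Pi$ is the hyperplane $X_1+X_5+X_9=0$ (trace-zero matrices), a copy of $\mathrm{PG}(7,q)$. $\Gamma$ is the point-line geometry whose points are the $(q+1)(q^2+q+1)$ points of $\Pi\cap\mathcal{S}_{2,2}$ and whose lines are the $2(q^2+q+1)$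 projective lines contained in $\Pi\cap\mathcal{S}_{2,2}$; it is a thin generalized hexagon, isomorphic to the point-line flag geometry of $\mathrm{PG}(2,q)$. Through each point $x$ of $\Gamma$ there pass exactly two lines of $\Gamma$; they span a plane, denoted $\pi_x$. -}

module Defs where

open import Level using (Level; _⊔_) renaming (suc to lsuc)
open import Algebra.Bundles using (CommutativeRing)
open import Algebra.Definitions using (Invertible)
open import Data.Fin.Base using (Fin)
open import Data.Fin.Patterns using (0F; 1F; 2F; 4F; 8F)
open import Data.Nat.Base using (ℕ; suc; _^_)
open import Data.Nat.Primality using (Prime)
open import Data.Product.Base using (∃; ∃₂; ∃-syntax; _×_)
open import Data.Vec.Functional using (Vector; []; _∷_; replicate)
open import Function.Bundles using (Inverse)
open import Relation.Binary.PropositionalEquality using (_≡_; setoid)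
open import Relation.Nullary using (¬_)
open import Relation.Unary using (Pred; _∈_; _⊆_; _≐_; _∩_)
import Algebra.Definitions.RawMonoid as RawMonoidDefinitions
import Data.Vec.Functional.Relation.Binary.Equality.Setoid as VectorEquality

IsPrimePower : ℕ → Set
IsPrimePower q = ∃₂ λ p k → Prime p × q ≡ p ^ suc k

record FiniteField (c ℓ : Level) (q : ℕ) : Set (lsuc (c ⊔ ℓ)) where
  field
    commutativeRing : CommutativeRing c ℓ
  open CommutativeRing commutativeRing public
    renaming (setoid to ≈-setoid)
  field
    1≉0         : ¬ (1# ≈ 0#)
    invertible  : ∀ x → ¬ (x ≈ 0#) → Invertible _≈_ 1# _*_ x
    enumeration : Inverse ≈-setoid (setoid (Fin q))

-- A subspace of PG(n - 1, q) is represented by the corresponding linear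
-- subspace of F^n, that is, by a set of vectors which also contains 0.
module ProjectiveSpace {c ℓ q} (F : FiniteField c ℓ q) where
  open FiniteField F
  open RawMonoidDefinitions +-rawMonoid using (sum)
  open VectorEquality ≈-setoid using (_≋_) public

  private variable
    k n : ℕ
    p   : Level

  0ᵛ : Vector Carrier n
  0ᵛ = replicate _ 0#

  infixl 6 _+ᵛ_
  _+ᵛ_ : Vector Carrier n → Vector Carrier n → Vector Carrier n
  (u +ᵛ v) i = u i + v i

  infixr 7 _·ᵛ_
  _·ᵛ_ : Carrier → Vector Carrier n → Vector Carrier n
  (s ·ᵛ v) i = s * v i

  linearCombination : Vector Carrier k → Vector (Vector Carrier n) k → Vector Carrier n
  linearCombination s b i = sum (λ j → s j * b j i)

  LinearlyIndependent : Vector (Vector Carrier n) k → Set (c ⊔ ℓ)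
  LinearlyIndependent b = ∀ s → linearCombination s b ≋ 0ᵛ → s ≋ 0ᵛ

  Span : Vector (Vector Carrier n) k → Pred (Vector Carrier n) (c ⊔ ℓ)
  Span b v = ∃[ s ] v ≋ linearCombination s b

  -- Projective dimension: the linear subspace has dimension suc d.
  IsSubspaceOfDim : ℕ → Pred (Vector Carrier n) p → Set (c ⊔ ℓ ⊔ p)
  IsSubspaceOfDim {n = n} d W =
    ∃ λ (b : Vector (Vector Carrier n) (suc d)) → LinearlyIndependent b × W ≐ Span b

  IsLine : Pred (Vector Carrier n) p → Set (c ⊔ ℓ ⊔ p)
  IsLine = IsSubspaceOfDim 1

  -- The subspace spanned by two subspaces.
  Join : ∀ {p₁ p₂} → Pred (Vector Carrier n) p₁ → Pred (Vector Carrier n) p₂ →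
         Pred (Vector Carrier n) (c ⊔ ℓ ⊔ p₁ ⊔ p₂)
  Join U W v = ∃₂ λ u w → u ∈ U × w ∈ W × v ≋ u +ᵛ w

  -- A point of PG(n - 1, q), given by homogeneous coordinates.
  record Point (n : ℕ) : Set (c ⊔ ℓ) where
    field
      coords  : Vector Carrier n
      nonzero : ¬ (coords ≋ 0ᵛ)
  open Point public

  Represents : Vector Carrier n → Pred (Point n) (c ⊔ ℓ)
  Represents v x = ∃[ s ] ¬ (s ≈ 0#) × coords x ≋ s ·ᵛ v

  points : Pred (Vector Carrier n) p → Pred (Point n) p
  points W x = coords x ∈ W

module ThinHexagon {c ℓ q} (F : FiniteField c ℓ q) where
  open FiniteField F
  open ProjectiveSpace F public

  segre : Vector Carrier 3 → Vector Carrier 3 → Vector Carrier 9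
  segre a b =
    a 0F * b 0F ∷ a 0F * b 1F ∷ a 0F * b 2F ∷
    a 1F * b 0F ∷ a 1F * b 1F ∷ a 1F * b 2F ∷
    a 2F * b 0F ∷ a 2F * b 1F ∷ a 2F * b 2F ∷ []

  𝒮₂₂ : Pred (Point 9) (c ⊔ ℓ)
  𝒮₂₂ x = ∃₂ λ a b → ¬ (a ≋ 0ᵛ) × ¬ (b ≋ 0ᵛ) × x ∈ Represents (segre a b)

  -- X₁ + X₅ + X₉ = 0, with coordinates indexed from 0.
  Π : Pred (Vector Carrier 9) ℓ
  Π v = v 0F + v 4F + v 8F ≈ 0#

  ΓPoint : Pred (Point 9) (c ⊔ ℓ)
  ΓPoint = points Π ∩ 𝒮₂₂

  ΓLine : Pred (Pred (Vector Carrier 9) (c ⊔ ℓ)) (c ⊔ ℓ)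
  ΓLine L = IsLine L × points L ⊆ ΓPoint

  -- Exactly two lines of Γ pass through each point x of Γ, so L₁ and L₂ below
  -- are determined up to order and π x is a single plane.
  π : Point 9 → Pred (Vector Carrier 9) (lsuc (c ⊔ ℓ))
  π x v = ∃₂ λ (L₁ L₂ : Pred (Vector Carrier 9) (c ⊔ ℓ)) →
    ΓLine L₁ × ΓLine L₂ × ¬ (L₁ ≐ L₂) ×
    x ∈ points L₁ × x ∈ points L₂ × v ∈ Join L₁ L₂

  𝒪 : Pred (Point 9) (lsuc (c ⊔ ℓ))
  𝒪 y = ∃[ x ] x ∈ ΓPoint × y ∈ points (π x)

  -- Π has projective dimension 7.
  IsHyperplaneOfΠ : Pred (Vector Carrier 9) (c ⊔ ℓ) → Set (c ⊔ ℓ)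
  IsHyperplaneOfΠ H = IsSubspaceOfDim 6 H × H ⊆ Π

{-# OPTIONS --safe #-}
-- Let a and b vanish at a common coordinate k and let a ⊗ b have trace zero.
-- Then the two lines of Γ through a ⊗ b are a ⊗ ⟨b, eₖ⟩ and ⟨a, eₖ⟩ ⊗ b, so
-- a ⊗ b ∈ 𝒪.  Such tensors span Π: the off-diagonal matrix units are of this
-- form, and (e₀ - e₁) ⊗ (e₀ + e₁) and (e₁ - e₂) ⊗ (e₁ + e₂) supply the diagonal.
-- A hyperplane containing 𝒪 would thus contain all of Π, and counting
-- coordinate vectors would give q⁸ ≤ q⁷.
module Submission where

open import Defs
open import Data.Nat using (ℕ; _%_)
open import Data.Product using (_×_; ∃-syntax)
open import Relation.Binary.PropositionalEquality using (_≡_)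
open import Relation.Nullary using (¬_)
open import Relation.Unary using (_⊆_)

open import Level using (_⊔_)
open import Data.Empty using (⊥-elim)
open import Data.Fin.Base using (Fin; suc; combine; quotient; remainder; finToFun; funToFin; punchIn; _↑ˡ_)
open import Data.Fin.Patterns using (0F; 1F; 2F; 3F; 4F; 5F; 6F; 7F; 8F)
open import Data.Fin.Properties using
  ( _≟_; all?; any?; punchInᵢ≢i; injective⇒≤; combine-remQuot
  ; finToFun-funToFin; funToFin-finToFin )
open import Data.Nat.Base using (_^_; _≤_; _<_)
open import Data.Nat.Properties using (≮⇒≥; <⇒≱; ^-monoʳ-<; n<1+n)
open import Data.Product using (_,_; proj₁; proj₂; ∃)
open import Data.Vec.Functional using (Vector; []; _∷_; _++_)
open import Data.Vec.Functional.Properties using (lookup-++ˡ)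
open import Function using (_∘_; flip)
open import Function.Bundles using (Inverse)
open import Relation.Binary.PropositionalEquality as ≡ using (_≢_; _≗_)
open import Relation.Nullary using (yes; no; contradiction; ¬?)
open import Relation.Nullary.Decidable using (from-yes; _×-dec_)
open import Relation.Unary using (Pred; _∈_; _≐_)
import Algebra.Properties.AbelianGroup as AbelianGroupProperties
import Algebra.Properties.Ring as RingProperties
import Algebra.Properties.Semiring.Sum as SemiringSum
import Relation.Binary.Reasoning.Setoid as ≈-Reasoning

-- Finite index sets and codes of tuples

∃-distinct : (i j : Fin 3) → ∃ λ k → k ≢ i × k ≢ j
∃-distinct = from-yes
  (all? {n = 3} {P = λ i → ∀ j → ∃ λ k → k ≢ i × k ≢ j} λ i → all? λ j → any? λ k → ¬? (k ≟ i) ×-dec ¬? (k ≟ j))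

-- Pointwise equal functions need not be propositionally equal, so the fact that a code depends on
-- the values alone is proved by recursion on the length.
funToFin-cong : ∀ {m n} {f g : Fin m → Fin n} → f ≗ g → funToFin f ≡ funToFin g
funToFin-cong {ℕ.zero}  f≗g = ≡.refl
funToFin-cong {ℕ.suc _} f≗g = ≡.cong₂ combine (f≗g 0F) (funToFin-cong (f≗g ∘ suc))

-- Arithmetic in the field

module LinearAlgebra {c ℓ q} (F : FiniteField c ℓ q) where
  open FiniteField F
  open ProjectiveSpace F
  open SemiringSum semiring
    using (sum; sum-cong-≋; sum-replicate-zero; sum-remove; ∑-distrib-+; *-distribˡ-sum)
  open ≈-Reasoning ≈-setoid

  private variable
    k m n : ℕ
    x y   : Carrier

  *-zeroʳ : y ≈ 0# → x * y ≈ 0#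
  *-zeroʳ y≈0 = trans (*-congˡ y≈0) (zeroʳ _)

  *-zeroˡ : x ≈ 0# → x * y ≈ 0#
  *-zeroˡ x≈0 = trans (*-congʳ x≈0) (zeroˡ _)

  +-zero : x ≈ 0# → y ≈ 0# → x + y ≈ 0#
  +-zero x≈0 y≈0 = trans (+-cong x≈0 y≈0) (+-identityˡ 0#)

  x*y≈0⇒y≈0 : ¬ (x ≈ 0#) → x * y ≈ 0# → y ≈ 0#
  x*y≈0⇒y≈0 {x} {y} x≉0 xy≈0 = let x⁻¹ , x⁻¹x≈1 , _ = invertible x x≉0 in begin
    y              ≈⟨ *-identityˡ y ⟨
    1# * y         ≈⟨ *-congʳ x⁻¹x≈1 ⟨
    (x⁻¹ * x) * y  ≈⟨ *-assoc x⁻¹ x y ⟩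
    x⁻¹ * (x * y)  ≈⟨ *-zeroʳ xy≈0 ⟩
    0#             ∎

  x*y≈0⇒x≈0 : ¬ (y ≈ 0#) → x * y ≈ 0# → x ≈ 0#
  x*y≈0⇒x≈0 y≉0 xy≈0 = x*y≈0⇒y≈0 y≉0 (trans (*-comm _ _) xy≈0)

  x*y≉0 : ¬ (x ≈ 0#) → ¬ (y ≈ 0#) → ¬ (x * y ≈ 0#)
  x*y≉0 x≉0 y≉0 xy≈0 = y≉0 (x*y≈0⇒y≈0 x≉0 xy≈0)

  *-swap : ∀ x y z → x * (y * z) ≈ y * (x * z)
  *-swap x y z = begin
    x * (y * z)  ≈⟨ *-assoc x y z ⟨
    x * y * z    ≈⟨ *-congʳ (*-comm x y) ⟩
    y * x * z    ≈⟨ *-assoc y x z ⟩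
    y * (x * z)  ∎

  -- Counting vectors over a field with `q` elements

  1<q : 1 < q
  1<q = injective⇒≤ {f = to ∘ f} λ {i} {j} eq → f-injective i j (to-injective eq)
    where
    open Inverse enumeration using (to; from; strictlyInverseʳ)

    f : Fin 2 → Carrier
    f 0F = 0#
    f 1F = 1#

    to-injective : to x ≡ to y → x ≈ y
    to-injective eq = trans (sym (strictlyInverseʳ _))
                     (trans (reflexive (≡.cong from eq)) (strictlyInverseʳ _))

    f-injective : ∀ i j → f i ≈ f j → i ≡ j
    f-injective 0F 0F _   = ≡.refl
    f-injective 0F 1F 0≈1 = ⊥-elim (1≉0 (sym 0≈1))
    f-injective 1F 0F 1≈0 = ⊥-elim (1≉0 1≈0)
    f-injective 1F 1F _   = ≡.refl

  -- Pigeonhole takes the place of basis exchange: there are q^m vectors of length m and q^n of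
  -- length n, and the powers of q grow strictly because 0 and 1 are distinct.
  injective⇒dim≤ : (f : Vector Carrier m → Vector Carrier n) →
                   (∀ s t → f s ≋ f t → s ≋ t) → m ≤ n
  injective⇒dim≤ {m} {n} f f-injective =
    ≮⇒≥ λ n<m → <⇒≱ (^-monoʳ-< q 1<q n<m) (injective⇒≤ {f = code} code-injective)
    where
    open Inverse enumeration using (to; from; strictlyInverseˡ; strictlyInverseʳ)

    decode : Fin (q ^ m) → Vector Carrier m
    decode i = from ∘ finToFun i

    -- Numbering the tuples on both sides turns `f` into a map between finite sets of sizes q^m and
    -- q^n.
    code : Fin (q ^ m) → Fin (q ^ n)
    code i = funToFin (to ∘ f (decode i))

    code-injective : ∀ {i j} → code i ≡ code j → i ≡ j
    code-injective {i} {j} eq =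
      ≡.trans (≡.sym (funToFin-finToFin {m} i))
      (≡.trans (funToFin-cong decoded) (funToFin-finToFin {m} j))
      where
      images : f (decode i) ≋ f (decode j)
      images l = begin
        f (decode i) l              ≈⟨ strictlyInverseʳ _ ⟨
        from (to (f (decode i) l))  ≡⟨ ≡.cong from (≡.sym (finToFun-funToFin (to ∘ f (decode i)) l)) ⟩
        from (finToFun (code i) l)  ≡⟨ ≡.cong (λ e → from (finToFun e l)) eq ⟩
        from (finToFun (code j) l)  ≡⟨ ≡.cong from (finToFun-funToFin (to ∘ f (decode j)) l) ⟩
        from (to (f (decode j) l))  ≈⟨ strictlyInverseʳ _ ⟩
        f (decode j) l              ∎

      decoded : finToFun {q} {m} i ≗ finToFun j
      decoded l = ≡.trans (≡.sym (strictlyInverseˡ _))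
        (≡.trans (Inverse.to-cong enumeration (f-injective _ _ images l)) (strictlyInverseˡ _))

  -- Subspaces and spans

  record IsSubspace {p} (W : Pred (Vector Carrier n) p) : Set (c ⊔ ℓ ⊔ p) where
    field
      -- Vectors are functions into a setoid, so invariance under `≋` has to be demanded separately.
      resp : ∀ {u v} → u ≋ v → u ∈ W → v ∈ W
      0∈   : 0ᵛ ∈ W
      +∈   : ∀ {u v} → u ∈ W → v ∈ W → u +ᵛ v ∈ W
      ·∈   : ∀ s {v} → v ∈ W → s ·ᵛ v ∈ W

    sum∈ : (b : Vector (Vector Carrier n) k) → (∀ j → b j ∈ W) → (λ i → sum (λ j → b j i)) ∈ W
    sum∈ {k = ℕ.zero}  b b∈W = 0∈
    sum∈ {k = ℕ.suc _} b b∈W = +∈ (b∈W 0F) (sum∈ (b ∘ suc) (b∈W ∘ suc))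

    Span⊆ : (b : Vector (Vector Carrier n) k) → (∀ j → b j ∈ W) → Span b ⊆ W
    Span⊆ b b∈W (s , v≋) =
      resp (λ i → sym (v≋ i)) (sum∈ (λ j → s j ·ᵛ b j) (λ j → ·∈ (s j) (b∈W j)))

  Span-isSubspace : (b : Vector (Vector Carrier n) k) → IsSubspace (Span b)
  Span-isSubspace {k = k} b = record
    { resp = λ u≋v (s , u≋) → s , λ i → trans (sym (u≋v i)) (u≋ i)
    ; 0∈   = 0ᵛ , λ i → sym (trans (sum-cong-≋ (λ j → zeroˡ (b j i))) (sum-replicate-zero k))
    ; +∈   = λ {u} {v} (s , u≋) (t , v≋) → s +ᵛ t , λ i → begin
        u i + v i                                          ≈⟨ +-cong (u≋ i) (v≋ i) ⟩
        linearCombination s b i + linearCombination t b i  ≈⟨ ∑-distrib-+ (λ j → s j * b j i) (λ j → t j * b j i) ⟨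
        sum (λ j → s j * b j i + t j * b j i)              ≈⟨ sum-cong-≋ (λ j → distribʳ (b j i) (s j) (t j)) ⟨
        linearCombination (s +ᵛ t) b i                     ∎
    ; ·∈   = λ r {v} (s , v≋) → r ·ᵛ s , λ i → begin
        r * v i                        ≈⟨ *-congˡ (v≋ i) ⟩
        r * linearCombination s b i    ≈⟨ *-distribˡ-sum r (λ j → s j * b j i) ⟩
        sum (λ j → r * (s j * b j i))  ≈⟨ sum-cong-≋ (λ j → *-assoc r (s j) (b j i)) ⟨
        linearCombination (r ·ᵛ s) b i ∎
    }

  -- Standard basis vectors

  ê : Fin n → Vector Carrier n
  ê i j with i ≟ j
  ... | yes _ = 1#
  ... | no  _ = 0#

  ê-diag : (i : Fin n) → ê i i ≈ 1#
  ê-diag i with i ≟ i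
  ... | yes _  = refl
  ... | no i≢i = contradiction ≡.refl i≢i

  ê-off : {i j : Fin n} → i ≢ j → ê i j ≈ 0#
  ê-off {i = i} {j} i≢j with i ≟ j
  ... | yes i≡j = contradiction i≡j i≢j
  ... | no  _   = refl

  ê-nonzero : (i : Fin n) → ¬ (ê i i ≈ 0#)
  ê-nonzero i eq = 1≉0 (trans (sym (ê-diag i)) eq)

  -- Isolating the summand at `i` leaves only zeros. Read for all `i` at once, this is the expansion
  -- of `t` in the standard basis.
  sum-ê : (i : Fin n) (t : Vector Carrier n) → sum (λ j → t j * ê j i) ≈ t i
  sum-ê {ℕ.suc n} i t = begin
    sum (λ j → t j * ê j i)
      ≈⟨ sum-remove {i = i} (λ j → t j * ê j i) ⟩
    t i * ê i i + sum (λ j → t (punchIn i j) * ê (punchIn i j) i)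
      ≈⟨ +-cong (trans (*-congˡ (ê-diag i)) (*-identityʳ _))
                (trans (sum-cong-≋ (λ j → *-zeroʳ (ê-off (punchInᵢ≢i i j)))) (sum-replicate-zero n)) ⟩
    t i + 0#
      ≈⟨ +-identityʳ _ ⟩
    t i ∎

  Span-member : (b : Vector (Vector Carrier n) k) (j : Fin k) → b j ∈ Span b
  Span-member b j = ê j , λ i → begin
    b j i                          ≈⟨ sum-ê j (λ l → b l i) ⟨
    -- `sum-ê` sums over the first index of `ê`, the coefficient vector `ê j` over the second;
    -- symmetry of `ê` reconciles the two.
    sum (λ l → b l i * ê l j)      ≈⟨ sum-cong-≋ (λ l → trans (*-comm _ _) (*-congʳ (ê-sym l j))) ⟩
    linearCombination (ê j) b i    ∎
    where
    ê-sym : (i j : Fin n) → ê i j ≈ ê j i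
    ê-sym i j with i ≟ j
    ... | yes ≡.refl = sym (ê-diag i)
    ... | no i≢j     = sym (ê-off (i≢j ∘ ≡.sym))

  -- The coordinates t of a vector of ⟨v, êₖ⟩ are read off at i and at k.
  independent-ê : (v : Vector Carrier n) {i k : Fin n} → ¬ (v i ≈ 0#) → v k ≈ 0# →
                  LinearlyIndependent (v ∷ ê k ∷ [])
  independent-ê v {i} {k} vᵢ≉0 vₖ≈0 t eq = λ where
      0F → x*y≈0⇒x≈0 vᵢ≉0 (begin
        t 0F * v i                        ≈⟨ +-identityʳ _ ⟨
        t 0F * v i + 0#                   ≈⟨ +-congˡ (+-zero (*-zeroʳ (ê-off k≢i)) refl) ⟨
        t 0F * v i + (t 1F * ê k i + 0#)  ≈⟨ eq i ⟩
        0#                                ∎)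
      1F → x*y≈0⇒x≈0 (ê-nonzero k) (begin
        t 1F * ê k k                      ≈⟨ +-identityʳ _ ⟨
        t 1F * ê k k + 0#                 ≈⟨ +-identityˡ _ ⟨
        0# + (t 1F * ê k k + 0#)          ≈⟨ +-congʳ (*-zeroʳ vₖ≈0) ⟨
        t 0F * v k + (t 1F * ê k k + 0#)  ≈⟨ eq k ⟩
        0#                                ∎)
    where
    k≢i : k ≢ i
    k≢i ≡.refl = vᵢ≉0 vₖ≈0

-- Rank-one matrices

module Hexagon {c ℓ q} (F : FiniteField c ℓ q) where
  open FiniteField F
  open ThinHexagon F
  open LinearAlgebra F
  open SemiringSum semiring using (sum; sum-cong-≋; *-distribˡ-sum)
  open AbelianGroupProperties +-abelianGroup using (inverseʳ-unique)
  open RingProperties ring using (-1*x≈-x)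
  open ≈-Reasoning ≈-setoid

  private variable
    k : ℕ

  -- Matrices are listed row by row, so division with remainder by 3 recovers the position of an
  -- entry, and `combine` is the inverse.
  row col : Fin 9 → Fin 3
  row = quotient 3
  col = remainder {3} 3

  -- `segre` is a literal list of nine products, so the uniform formula is obtained by evaluating at
  -- each index.
  segre-entry : ∀ a b n → segre a b n ≡ a (row n) * b (col n)
  segre-entry a b 0F = ≡.refl
  segre-entry a b 1F = ≡.refl
  segre-entry a b 2F = ≡.refl
  segre-entry a b 3F = ≡.refl
  segre-entry a b 4F = ≡.refl
  segre-entry a b 5F = ≡.refl
  segre-entry a b 6F = ≡.refl
  segre-entry a b 7F = ≡.refl
  segre-entry a b 8F = ≡.refl

  segre-combine : ∀ a b i j → segre a b (combine i j) ≡ a i * b j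
  segre-combine a b = λ where
    0F 0F → ≡.refl
    0F 1F → ≡.refl
    0F 2F → ≡.refl
    1F 0F → ≡.refl
    1F 1F → ≡.refl
    1F 2F → ≡.refl
    2F 0F → ≡.refl
    2F 1F → ≡.refl
    2F 2F → ≡.refl

  segre-linearʳ : ∀ a (s : Vector Carrier k) B →
    segre a (linearCombination s B) ≋ linearCombination s (segre a ∘ B)
  segre-linearʳ a s B n = begin
    segre a (linearCombination s B) n                      ≡⟨ segre-entry a (linearCombination s B) n ⟩
    a (row n) * linearCombination s B (col n)              ≈⟨ *-distribˡ-sum (a (row n)) (λ j → s j * B j (col n)) ⟩
    sum (λ j → a (row n) * (s j * B j (col n)))            ≈⟨ sum-cong-≋ (λ j → *-swap (a (row n)) (s j) (B j (col n))) ⟩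
    sum (λ j → s j * (a (row n) * B j (col n)))            ≈⟨ sum-cong-≋ (λ j → *-congˡ (reflexive (segre-entry a (B j) n))) ⟨
    linearCombination s (segre a ∘ B) n                    ∎

  segre-linearˡ : ∀ b (s : Vector Carrier k) A →
    segre (linearCombination s A) b ≋ linearCombination s (flip segre b ∘ A)
  segre-linearˡ b s A n = begin
    segre (linearCombination s A) b n                      ≡⟨ segre-entry (linearCombination s A) b n ⟩
    linearCombination s A (row n) * b (col n)              ≈⟨ *-comm _ _ ⟩
    b (col n) * linearCombination s A (row n)              ≈⟨ *-distribˡ-sum (b (col n)) (λ j → s j * A j (row n)) ⟩
    sum (λ j → b (col n) * (s j * A j (row n)))            ≈⟨ sum-cong-≋ (λ j → trans (*-swap (b (col n)) (s j) (A j (row n))) (*-congˡ (*-comm _ _))) ⟩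
    sum (λ j → s j * (A j (row n) * b (col n)))            ≈⟨ sum-cong-≋ (λ j → *-congˡ (reflexive (segre-entry (A j) b n))) ⟨
    linearCombination s (flip segre b ∘ A) n               ∎

  segre-zeroˡ : ∀ a b → a ≋ 0ᵛ → segre a b ≋ 0ᵛ
  segre-zeroˡ a b a≋0 n = trans (reflexive (segre-entry a b n)) (*-zeroˡ (a≋0 (row n)))

  segre-zeroʳ : ∀ a b → b ≋ 0ᵛ → segre a b ≋ 0ᵛ
  segre-zeroʳ a b b≋0 n = trans (reflexive (segre-entry a b n)) (*-zeroʳ (b≋0 (col n)))

  -- Row `i` of a ⊗ b is `a i` times b, and a nonzero factor can be cancelled. This makes a ⊗ b a
  -- genuine point and carries linear independence over to the generators of a line.
  segre-cancelˡ : ∀ a b {i} → ¬ (a i ≈ 0#) → segre a b ≋ 0ᵛ → b ≋ 0ᵛ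
  segre-cancelˡ a b {i} aᵢ≉0 eq j =
    x*y≈0⇒y≈0 aᵢ≉0 (trans (reflexive (≡.sym (segre-combine a b i j))) (eq (combine i j)))

  segre-cancelʳ : ∀ a b {j} → ¬ (b j ≈ 0#) → segre a b ≋ 0ᵛ → a ≋ 0ᵛ
  segre-cancelʳ a b {j} bⱼ≉0 eq i =
    x*y≈0⇒x≈0 bⱼ≉0 (trans (reflexive (≡.sym (segre-combine a b i j))) (eq (combine i j)))

  -- Trace zero, lines of Γ and points of 𝒪

  Π-isSubspace : IsSubspace Π
  Π-isSubspace = record
    { resp = λ u≋v → trans (sym (+-cong (+-cong (u≋v 0F) (u≋v 4F)) (u≋v 8F)))
    ; 0∈   = +-zero (+-zero refl refl) refl
    ; +∈   = λ {u} {v} u∈Π v∈Π → begin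
        (u 0F + v 0F) + (u 4F + v 4F) + (u 8F + v 8F)  ≈⟨ +-congʳ (interchange _ _ _ _) ⟩
        (u 0F + u 4F) + (v 0F + v 4F) + (u 8F + v 8F)  ≈⟨ interchange _ _ _ _ ⟩
        (u 0F + u 4F + u 8F) + (v 0F + v 4F + v 8F)    ≈⟨ +-zero u∈Π v∈Π ⟩
        0#                                             ∎
    ; ·∈   = λ s {v} v∈Π → begin
        s * v 0F + s * v 4F + s * v 8F  ≈⟨ +-congʳ (distribˡ _ _ _) ⟨
        s * (v 0F + v 4F) + s * v 8F    ≈⟨ distribˡ _ _ _ ⟨
        s * (v 0F + v 4F + v 8F)        ≈⟨ *-zeroʳ v∈Π ⟩
        0#                              ∎
    }
    where open import Algebra.Properties.CommutativeSemigroup +-commutativeSemigroup using (interchange)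

  -- The trace of a ⊗ b is the dot product of a and b. Here every term vanishes separately, which
  -- covers factors with disjoint supports.
  segre∈Π : ∀ a b → (∀ i → a i * b i ≈ 0#) → segre a b ∈ Π
  segre∈Π a b eq = +-zero (+-zero (eq 0F) (eq 1F)) (eq 2F)

  -- T will be a ⊗_ or _⊗ b.
  image-ΓLine : (T : Vector Carrier 3 → Vector Carrier 9) (B : Vector (Vector Carrier 3) 2) →
    (∀ s → T (linearCombination s B) ≋ linearCombination s (T ∘ B)) →
    (∀ {v} → v ≋ 0ᵛ → T v ≋ 0ᵛ) →
    (∀ {v} → T v ≋ 0ᵛ → v ≋ 0ᵛ) →
    (∀ {v} x → ¬ (v ≋ 0ᵛ) → coords x ≋ T v → x ∈ 𝒮₂₂) →
    (∀ j → T (B j) ∈ Π) →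
    LinearlyIndependent B →
    ΓLine (Span (T ∘ B))
  image-ΓLine T B linear T-zero T-cancel T∈𝒮 TB∈Π independent =
    ( T ∘ B
    , (λ s eq → independent s (T-cancel (λ n → trans (linear s n) (eq n))))
    , (λ v∈ → v∈) , (λ v∈ → v∈) ) ,
    λ {x} (s , x≋) →
      let x≋T = λ n → trans (x≋ n) (sym (linear s n)) in
      IsSubspace.Span⊆ Π-isSubspace (T ∘ B) TB∈Π (s , x≋) ,
      T∈𝒮 x (λ v≋0 → nonzero x (λ n → trans (x≋T n) (T-zero v≋0 n))) x≋T

  segre∈𝒮 : ∀ {a b} x → ¬ (a ≋ 0ᵛ) → ¬ (b ≋ 0ᵛ) → coords x ≋ segre a b → x ∈ 𝒮₂₂
  segre∈𝒮 {a} {b} x a≉0 b≉0 x≋ =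
    a , b , a≉0 , b≉0 , 1# , 1≉0 , λ n → trans (x≋ n) (sym (*-identityˡ _))

  module _ (a b : Vector Carrier 3) {i j : Fin 3} (aᵢ≉0 : ¬ (a i ≈ 0#)) (bⱼ≉0 : ¬ (b j ≈ 0#)) where

    segrePoint : Point 9
    segrePoint = record
      { coords  = segre a b
      ; nonzero = λ eq → bⱼ≉0 (segre-cancelˡ a b aᵢ≉0 eq j)
      }

    -- The point is placed in its own plane, as itself plus the zero vector, so it suffices to
    -- exhibit two distinct lines of Γ through it. Since both factors vanish at `k`, replacing
    -- either of them by `ê k` keeps the trace zero and yields the second generator of one of the
    -- lines.
    segrePoint∈𝒪 : ∀ k → a k ≈ 0# → b k ≈ 0# → segre a b ∈ Π → segrePoint ∈ 𝒪
    segrePoint∈𝒪 k aₖ≈0 bₖ≈0 ab∈Π =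
      segrePoint , (ab∈Π , segre∈𝒮 segrePoint a≉0 b≉0 (λ _ → refl)) ,
      Span L₁ , Span L₂ , L₁-ΓLine , L₂-ΓLine , L₁≢L₂ ,
      Span-member L₁ 0F , Span-member L₂ 0F ,
      segre a b , 0ᵛ , Span-member L₁ 0F , IsSubspace.0∈ (Span-isSubspace L₂) ,
      λ n → sym (+-identityʳ _)
      where
      A B : Vector (Vector Carrier 3) 2
      A = a ∷ ê k ∷ []
      B = b ∷ ê k ∷ []

      L₁ L₂ : Vector (Vector Carrier 9) 2
      L₁ = segre a ∘ B
      L₂ = flip segre b ∘ A

      a≉0 : ¬ (a ≋ 0ᵛ)
      a≉0 a≋0 = aᵢ≉0 (a≋0 i)

      b≉0 : ¬ (b ≋ 0ᵛ)
      b≉0 b≋0 = bⱼ≉0 (b≋0 j)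

      -- At `k` the first factor vanishes, elsewhere the second does.
      disjoint : ∀ {v : Vector Carrier 3} → v k ≈ 0# → ∀ m → v m * ê k m ≈ 0#
      disjoint vₖ≈0 m with k ≟ m
      ... | yes ≡.refl = *-zeroˡ vₖ≈0
      ... | no _       = zeroʳ _

      L₁-ΓLine : ΓLine (Span L₁)
      L₁-ΓLine = image-ΓLine (segre a) B (λ s → segre-linearʳ a s B)
        (λ {v} → segre-zeroʳ a v) (λ {v} → segre-cancelˡ a v aᵢ≉0) (λ x → segre∈𝒮 x a≉0)
        (λ { 0F → ab∈Π ; 1F → segre∈Π a (ê k) (disjoint aₖ≈0) })
        (independent-ê b bⱼ≉0 bₖ≈0)

      L₂-ΓLine : ΓLine (Span L₂)
      L₂-ΓLine = image-ΓLine (flip segre b) A (λ s → segre-linearˡ b s A)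
        (λ {v} → segre-zeroˡ v b) (λ {v} → segre-cancelʳ v b bⱼ≉0) (λ x v≉0 → segre∈𝒮 x v≉0 b≉0)
        (λ { 0F → ab∈Π ; 1F → segre∈Π (ê k) b (λ m → trans (*-comm _ _) (disjoint bₖ≈0 m)) })
        (independent-ê a aᵢ≉0 aₖ≈0)

      -- All matrices on L₂ have column k zero, but a ⊗ êₖ does not.
      L₁≢L₂ : ¬ (Span L₁ ≐ Span L₂)
      L₁≢L₂ (L₁⊆L₂ , _) with L₁⊆L₂ (Span-member L₁ 1F)
      ... | s , eq = x*y≉0 aᵢ≉0 (ê-nonzero k) (begin
        a i * ê k k                              ≡⟨ segre-combine a (ê k) i k ⟨
        segre a (ê k) (combine i k)              ≈⟨ eq (combine i k) ⟩
        linearCombination s L₂ (combine i k)     ≈⟨ segre-linearˡ b s A (combine i k) ⟨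
        segre (linearCombination s A) b (combine i k)  ≡⟨ segre-combine (linearCombination s A) b i k ⟩
        linearCombination s A i * b k            ≈⟨ *-zeroʳ bₖ≈0 ⟩
        0#                                       ∎)

  -- The subspace spanned by 𝒪 and its dimension

  combine-row-col : ∀ n → combine (row n) (col n) ≡ n
  combine-row-col = combine-remQuot {3} 3

  -- Distinct indices differ in row or column, and the corresponding factor is then zero. The last
  -- case, where both agree, is impossible because row and column determine the index.
  ê-segre : ∀ n → ê n ≋ segre (ê (row n)) (ê (col n))
  ê-segre n m with n ≟ m | row n ≟ row m | col n ≟ col m
  ... | yes ≡.refl | _ | _ = sym (begin
    segre (ê (row n)) (ê (col n)) n            ≡⟨ segre-entry (ê (row n)) (ê (col n)) n ⟩
    ê (row n) (row n) * ê (col n) (col n)      ≈⟨ *-cong (ê-diag (row n)) (ê-diag (col n)) ⟩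
    1# * 1#                                    ≈⟨ *-identityˡ 1# ⟩
    1#                                         ∎)
  ... | no _ | no r≢ | _ =
    sym (trans (reflexive (segre-entry (ê (row n)) (ê (col n)) m)) (*-zeroˡ (ê-off r≢)))
  ... | no _ | _ | no c≢ =
    sym (trans (reflexive (segre-entry (ê (row n)) (ê (col n)) m)) (*-zeroʳ (ê-off c≢)))
  ... | no n≢m | yes r≡ | yes c≡ =
    contradiction (≡.trans (≡.sym (combine-row-col n)) (≡.trans (≡.cong₂ combine r≡ c≡) (combine-row-col m))) n≢m

  module _ {p} {W : Pred (Vector Carrier 9) p} (W-isSubspace : IsSubspace W)
           (𝒪⊆W : 𝒪 ⊆ points W) where
    open IsSubspace W-isSubspace

    segre∈W : ∀ a b {i j} → ¬ (a i ≈ 0#) → ¬ (b j ≈ 0#) →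
              ∀ k → a k ≈ 0# → b k ≈ 0# → segre a b ∈ Π → segre a b ∈ W
    segre∈W a b aᵢ≉0 bⱼ≉0 k aₖ≈0 bₖ≈0 ab∈Π =
      𝒪⊆W {segrePoint a b aᵢ≉0 bⱼ≉0} (segrePoint∈𝒪 a b aᵢ≉0 bⱼ≉0 k aₖ≈0 bₖ≈0 ab∈Π)

    -- The remaining index `k` is a common zero of both basis vectors, and their disjoint supports
    -- give trace zero.
    unit∈W : ∀ {i j} → i ≢ j → segre (ê i) (ê j) ∈ W
    unit∈W {i} {j} i≢j with ∃-distinct i j
    ... | k , k≢i , k≢j =
      segre∈W (ê i) (ê j) (ê-nonzero i) (ê-nonzero j) k
        (ê-off (k≢i ∘ ≡.sym)) (ê-off (k≢j ∘ ≡.sym)) (segre∈Π (ê i) (ê j) disjoint)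
      where
      disjoint : ∀ m → ê i m * ê j m ≈ 0#
      disjoint m with i ≟ m
      ... | yes ≡.refl = *-zeroʳ (ê-off (i≢j ∘ ≡.sym))
      ... | no _       = zeroˡ _

    -- In the expansion of `v` in matrix units, the diagonal units, which lie outside Π, have
    -- coefficient zero; the other units are covered by `unit∈W`.
    hollow∈W : ∀ v → (∀ i → v (combine i i) ≈ 0#) → v ∈ W
    hollow∈W v diag≈0 =
      resp (λ m → sum-ê m v) (sum∈ (λ n → v n ·ᵛ ê n) term∈W)
      where
      term∈W : ∀ n → v n ·ᵛ ê n ∈ W
      term∈W n with row n ≟ col n
      ... | no r≢c = resp (λ m → *-congˡ (sym (ê-segre n m))) (·∈ (v n) (unit∈W r≢c))
      ... | yes r≡c = resp (λ m → sym (*-zeroˡ vₙ≈0)) 0∈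
        where
        vₙ≈0 : v n ≈ 0#
        vₙ≈0 = begin
          v n                          ≡⟨ ≡.cong v (combine-row-col n) ⟨
          v (combine (row n) (col n))  ≡⟨ ≡.cong (λ i → v (combine i (col n))) r≡c ⟩
          v (combine (col n) (col n))  ≈⟨ diag≈0 (col n) ⟩
          0#                           ∎

    -- The tensors a₁ ⊗ b₁ and a₂ ⊗ b₂ have diagonals (1, -1, 0) and (0, 1, -1), which generate all
    -- trace-zero diagonals in every characteristic. The factors vanish together at coordinate 2 and
    -- at coordinate 0 respectively.
    a₁ b₁ a₂ b₂ : Vector Carrier 3
    a₁ = 1# ∷ - 1# ∷ 0# ∷ []
    b₁ = 1# ∷ 1# ∷ 0# ∷ []
    a₂ = 0# ∷ 1# ∷ - 1# ∷ []
    b₂ = 0# ∷ 1# ∷ 1# ∷ []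

    1*1-1*1≈0 : 1# * 1# + - 1# * 1# ≈ 0#
    1*1-1*1≈0 = trans (+-cong (*-identityʳ _) (*-identityʳ _)) (-‿inverseʳ 1#)

    D₁∈W : segre a₁ b₁ ∈ W
    D₁∈W = segre∈W a₁ b₁ {0F} {0F} 1≉0 1≉0 2F refl refl
      (+-zero 1*1-1*1≈0 (zeroˡ _))

    D₂∈W : segre a₂ b₂ ∈ W
    D₂∈W = segre∈W a₂ b₂ {1F} {1F} 1≉0 1≉0 0F refl refl
      (trans (+-congʳ (trans (+-congʳ (zeroˡ _)) (+-identityˡ _))) 1*1-1*1≈0)

    -- Subtracting from `v` a combination `d` of the two special tensors with the same diagonal
    -- leaves a matrix with zero diagonal.
    Π⊆W : Π ⊆ W
    Π⊆W {v} v∈Π = resp split (+∈ (hollow∈W w w-diag) d∈W)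
      where
      -- The diagonal of `d` is (s, t - s, -t); matching its first two entries with those of `v`
      -- determines `s` and `t`.
      s t : Carrier
      s = v 0F
      t = v 0F + v 4F

      d w : Vector Carrier 9
      d = s ·ᵛ segre a₁ b₁ +ᵛ t ·ᵛ segre a₂ b₂
      w n = v n + - d n

      d∈W : d ∈ W
      d∈W = +∈ (·∈ s D₁∈W) (·∈ t D₂∈W)

      split : w +ᵛ d ≋ v
      split n = begin
        v n + - d n + d n    ≈⟨ +-assoc _ _ _ ⟩
        v n + (- d n + d n)  ≈⟨ +-congˡ (-‿inverseˡ _) ⟩
        v n + 0#             ≈⟨ +-identityʳ _ ⟩
        v n                  ∎

      *1*1 : ∀ x → x * (1# * 1#) ≈ x
      *1*1 x = trans (*-congˡ (*-identityˡ 1#)) (*-identityʳ x)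

      *-1*1 : ∀ x → x * (- 1# * 1#) ≈ - x
      *-1*1 x = trans (*-congˡ (*-identityʳ _)) (trans (*-comm _ _) (-1*x≈-x x))

      d-diag : ∀ i → d (combine i i) ≈ v (combine i i)
      d-diag 0F = begin
        s * (1# * 1#) + t * (0# * 0#)    ≈⟨ +-cong (*1*1 s) (*-zeroʳ (zeroˡ 0#)) ⟩
        v 0F + 0#                        ≈⟨ +-identityʳ _ ⟩
        v 0F                             ∎
      d-diag 1F = begin
        s * (- 1# * 1#) + t * (1# * 1#)  ≈⟨ +-cong (*-1*1 s) (*1*1 t) ⟩
        - v 0F + (v 0F + v 4F)           ≈⟨ +-assoc _ _ _ ⟨
        - v 0F + v 0F + v 4F             ≈⟨ +-congʳ (-‿inverseˡ _) ⟩
        0# + v 4F                        ≈⟨ +-identityˡ _ ⟩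
        v 4F                             ∎
      d-diag 2F = begin
        s * (0# * 0#) + t * (- 1# * 1#)  ≈⟨ +-cong (*-zeroʳ (zeroˡ 0#)) (*-1*1 t) ⟩
        0# + - t                         ≈⟨ +-identityˡ _ ⟩
        -- The third diagonal entry matches because `v` has trace zero.
        - (v 0F + v 4F)                  ≈⟨ inverseʳ-unique _ _ v∈Π ⟨
        v 8F                             ∎

      w-diag : ∀ i → w (combine i i) ≈ 0#
      w-diag i = trans (+-congˡ (-‿cong (d-diag i))) (-‿inverseʳ _)

  -- Π is parametrised by its first eight coordinates. Choosing coefficients over `b` for each
  -- vector of Π is injective, since the coefficients determine the vector; so 8-tuples inject into
  -- k-tuples.
  Π⊆Span⇒8≤ : ∀ {k} (b : Vector (Vector Carrier 9) k) → Π ⊆ Span b → 8 ≤ k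
  Π⊆Span⇒8≤ b Π⊆b = injective⇒dim≤ (proj₁ ∘ coefficients) λ s t eq i → begin
    s i                                                        ≡⟨ lookup-++ˡ s _ i ⟨
    complete s (i ↑ˡ 1)                                        ≈⟨ proj₂ (coefficients s) (i ↑ˡ 1) ⟩
    linearCombination (proj₁ (coefficients s)) b (i ↑ˡ 1)      ≈⟨ sum-cong-≋ (λ j → *-congʳ (eq j)) ⟩
    linearCombination (proj₁ (coefficients t)) b (i ↑ˡ 1)      ≈⟨ proj₂ (coefficients t) (i ↑ˡ 1) ⟨
    complete t (i ↑ˡ 1)                                        ≡⟨ lookup-++ˡ t _ i ⟩
    t i                                                        ∎
    where
    -- The ninth coordinate is the one that trace zero forces.
    complete : Vector Carrier 8 → Vector Carrier 9
    complete s = s ++ (- (s 0F + s 4F) ∷ [])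

    coefficients : ∀ s → complete s ∈ Span b
    coefficients s = Π⊆b (-‿inverseʳ (s 0F + s 4F))

mainTheorem2 : ∀ {c ℓ} (q : ℕ) → IsPrimePower q → q % 3 ≡ 1 →
    (F : FiniteField c ℓ q) → let open ThinHexagon F in
    ¬ (∃[ H ] IsHyperplaneOfΠ H × 𝒪 ⊆ points H)
mainTheorem2 q _ _ F (H , ((b , _ , H⊆b , _) , _) , 𝒪⊆H) =
  -- Projective dimension 6 means that `b` consists of seven vectors, so 8 ≤ 7 would follow. The
  -- span of `b` stands in for `H`, as closure under the vector operations is available for spans.
  <⇒≱ (n<1+n 7) (Π⊆Span⇒8≤ b (Π⊆W (Span-isSubspace b) λ {y} y∈𝒪 → H⊆b (𝒪⊆H {y} y∈𝒪)))
  where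
  open LinearAlgebra F
  open Hexagon F
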